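{- Let $n$ be a positive integer. For any two subsets $I,J\subseteq[n-1]$ with the same associated partition, there exists a bijection between $\{\pi\in\mathcal{S}_n : D(\pi)\subseteq I\}$ and $\{\sigma\in\mathcal{S}_n : D(\sigma)\subseteq J\}$ that preserves the cycle structure.
   Context: $[n]=\{1,\dots,n\}$; $\mathcal{S}_n$ is the set of permutations of $[n]$; $D(\pi)=\{i : 1\le i\le n-1,\ \pi(i)>\pi(i+1)\}$. The cycle structure of a permutation is the partition of $n$ whose parts are the lengths of its cycles (fixed points included). For $I=\{i_1<i_2<\dots<i_k\}\subseteq[n-1]$, the associated composition of $n$ is $(i_1,i_2-i_1,\dots,i_k-i_{k-1},n-i_k)$, and the associated partition of $I$ is the partition of $n$ obtained by listing the parts of this composition in non-increasing order. -}

module Defs where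

open import Data.Bool.Properties using () renaming (_≟_ to _≟ᵇ_)
open import Data.Fin.Base using (Fin; suc; inject₁; toℕ)
open import Data.Fin.Permutation using (Permutation′; _⟨$⟩ʳ_)
open import Data.Fin.Properties using (_<?_)
open import Data.Fin.Subset using (Subset; ⁅_⁆; ⋃; ∣_∣; _⊆_)
open import Data.Fin.Subset.Properties using (_∈?_)
open import Data.List.Base using (List; []; _∷_; [_]; map; filter; allFin; iterate; deduplicate)
open import Data.List.Sort using (sort)
open import Data.Nat.Base using (ℕ; suc; _∸_)
open import Data.Nat.Properties using (≤-decTotalOrder)
open import Data.Product.Base using (Σ; proj₁)
open import Data.Vec.Base using (tabulate)
open import Data.Vec.Properties using (≡-dec)
open import Level using (0ℓ)
open import Relation.Binary.Bundles using (Setoid)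
import Relation.Binary.Construct.On as On
open import Relation.Binary.Properties.DecTotalOrder ≤-decTotalOrder using (≥-decTotalOrder)
open import Relation.Binary.PropositionalEquality using (_→-setoid_)
open import Relation.Nullary.Decidable.Core using (does)

-- Conventions, for n = suc m: i : Fin n stands for toℕ i + 1 ∈ [n], and
-- likewise i : Fin m stands for toℕ i + 1 ∈ [n-1].  A partition is a list of
-- its parts in non-increasing order.

sortDescending : List ℕ → List ℕ
sortDescending = sort ≥-decTotalOrder

-- inject₁ i and suc i are the positions written i and i + 1 in π(i) > π(i+1).

D : ∀ {m} → Permutation′ (suc m) → Subset m
D π = tabulate λ i → does (π ⟨$⟩ʳ suc i <? π ⟨$⟩ʳ inject₁ i)

-- A Permutation′ and its membership proof carry more data than the function
-- Fin n → Fin n; two elements are identified when these functions agree.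

DescentsWithin : ∀ {m} → Subset m → Setoid 0ℓ 0ℓ
DescentsWithin {m} I =
  On.setoid {B = Σ (Permutation′ (suc m)) λ π → D π ⊆ I}
            (Fin (suc m) →-setoid Fin (suc m)) (λ p → proj₁ p ⟨$⟩ʳ_)

-- The n points i, π(i), …, πⁿ⁻¹(i) exhaust the cycle of i, because its length
-- is at most n; repetitions vanish on passing to the set.

cycleOf : ∀ {n} → Permutation′ n → Fin n → Subset n
cycleOf {n} π i = ⋃ (map ⁅_⁆ (iterate (π ⟨$⟩ʳ_) i n))

cycles : ∀ {n} → Permutation′ n → List (Subset n)
cycles {n} π = deduplicate (≡-dec _≟ᵇ_) (map (cycleOf π) (allFin n))

cycleStructure : ∀ {n} → Permutation′ n → List ℕ
cycleStructure π = sortDescending (map ∣_∣ (cycles π))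

-- The members of I in increasing order, as the numbers they stand for.

elements : ∀ {m} → Subset m → List ℕ
elements {m} I = map (λ i → suc (toℕ i)) (filter (_∈? I) (allFin m))

-- differences n p (i₁ ∷ … ∷ iₖ ∷ []) = i₁ - p ∷ i₂ - i₁ ∷ … ∷ n - iₖ ∷ [].

differences : ℕ → ℕ → List ℕ → List ℕ
differences n p []       = [ n ∸ p ]
differences n p (i ∷ is) = (i ∸ p) ∷ differences n i is

associatedComposition : ∀ {m} → Subset m → List ℕ
associatedComposition {m} I = differences (suc m) 0 (elements I)

associatedPartition : ∀ {m} → Subset m → List ℕ
associatedPartition I = sortDescending (associatedComposition I)

{-# OPTIONS --safe #-}

-- A permutation π with D(π) ⊆ I is one that increases on each block of
-- consecutive positions cut out by I.  Label each x by its block and read the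
-- infinite word of labels along x, π(x), π²(x), …: the usual order on [n] is then
-- the lexicographic order of these words, ties being broken by x itself.  Equal
-- associated partitions give a renaming of the labels that turns block sizes of I
-- into those of J.  Sorting [n] by the renamed words, with the same tie-breaking,
-- yields a permutation r, and π ↦ r π r⁻¹ is the bijection: a conjugate has the
-- same cycle structure, r π r⁻¹ increases on the blocks of J because deleting the
-- common first letter of two words preserves their order, and undoing the
-- renaming restores the original order.  This is a form of the Gessel–Reutenauer
-- correspondence that avoids necklaces.

module Submission where

open import Defs
import Data.Nat.Properties as ℕ
open import Algebra.Properties.CommutativeMonoid.Sum ℕ.+-0-commutativeMonoid using (sum; sum-permute; sum-cong-≗)
open import Data.Bool.Base using (true; if_then_else_)
open import Data.Bool.Properties using () renaming (_≟_ to _≟ᵇ_)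
import Data.Empty as Empty
open import Data.Fin.Base using (Fin; zero; suc; inject₁; toℕ; fromℕ<; combine; punchOut; _<_; _≤_)
open import Data.Fin.Permutation as Perm
  using (Permutation′; permutation; _⟨$⟩ʳ_; _⟨$⟩ˡ_; _≈_; inverseˡ; inverseʳ; flip; _∘ₚ_)
open import Data.Fin.Properties
  using (_≟_; _<?_; <-cmp; any?; toℕ-inject₁; toℕ-injective; toℕ-fromℕ<; toℕ<n; ≤∧≢⇒<; punchOut-injective;
         injective⇒≤; injective⇒existsPivot; pigeonhole; combine-injective)
open import Data.Fin.Subset using (Subset; inside; outside; ⁅_⁆; ⋃; ∣_∣; _∈_; _∉_; _⊆_)
open import Data.Fin.Subset.Properties
  using (_∈?_; drop-there; ⊆-antisym; ∉⊥; ∈⊤; ∣⊤∣≡n; x∈⁅x⁆; x∈⁅y⁆⇒x≡y; x∈p∪q⁺; x∈p∪q⁻; p⊂q⇒∣p∣<∣q∣)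
open import Data.List.Base as List using (List; []; _∷_; map; filter; allFin)
open import Data.List.Membership.Propositional using () renaming (_∈_ to _∈ˡ_)
open import Data.List.Membership.Propositional.Properties
  using (∈-map⁺; ∈-map⁻; ∈-allFin; ∈-deduplicate⁺; ∈-deduplicate⁻)
open import Data.List.Membership.Propositional.Properties.WithK using (unique∧set⇒bag)
open import Data.List.Properties using (map-∘; map-cong; map-tabulate)
open import Data.List.Relation.Binary.BagAndSetEquality using (∼bag⇒↭)
open import Data.List.Relation.Binary.Permutation.Propositional as ↭
  using (_↭_; ↭⇒↭ₛ; ↭-sym; ↭-trans; ↭-reflexive)
open import Data.List.Relation.Binary.Permutation.Propositional.Properties using () renaming (map⁺ to ↭-map⁺)
open import Data.List.Relation.Binary.Pointwise using (Pointwise-≡⇒≡)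
open import Data.List.Relation.Unary.Any using (here; there)
open import Data.List.Relation.Unary.Sorted.TotalOrder.Properties using (↗↭↗⇒≋)
import Data.List.Relation.Unary.Unique.DecPropositional.Properties as DecUnique
import Data.List.Relation.Unary.Unique.Propositional.Properties as Unique
open import Relation.Binary.Properties.DecTotalOrder ℕ.≤-decTotalOrder using (≥-decTotalOrder)
open import Data.List.Sort ≥-decTotalOrder using (sort-↭; sort-↗)
open import Data.Nat.Base as ℕ using (ℕ; zero; suc; _+_; _*_; _∸_; z≤n; s≤s; z<s; s<s⁻¹)
open import Data.Nat.GeneralisedArithmetic using (iterate)
open import Data.Nat.Induction using (<-rec)
open import Data.Product.Base using (Σ-syntax; ∃-syntax; _×_; _,_; proj₁; proj₂)
open import Data.Sum.Base using (_⊎_; inj₁; inj₂; map₁)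
open import Data.Sum.Function.Propositional using () renaming (_⊎-cong_ to _⊎-↔_)
open import Data.Vec.Base using ([]; _∷_; here; there; lookup; tabulate)
open import Data.Vec.Properties
  using (≡-dec; lookup∘tabulate; tabulate∘lookup; tabulate-cong; []=⇒lookup; lookup⇒[]=)
open import Function.Base using (_∘_; id)
open import Function.Bundles
  using (_⇔_; mk⇔; Equivalence; _↔_; mk↔ₛ′; Inverse; Injection; Bijection)
open import Function.Definitions using (Injective)
open import Function.Properties.Equivalence using () renaming (refl to ⇔-refl; sym to ⇔-sym; trans to ⇔-trans)
open import Function.Properties.Inverse using (↔-refl; ↔-sym; ↔-trans; ↔⇒↣; Inverse⇒Bijection)
open import Level using (0ℓ)
open import Relation.Binary.Bundles using (Setoid; DecTotalOrder)
open import Relation.Binary.Core using (Rel)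
open import Relation.Binary.Definitions using (Trichotomous; tri<; tri≈; tri>)
open import Relation.Binary.PropositionalEquality
  using (_≡_; _≢_; refl; sym; trans; cong; cong₂; subst; subst₂; isEquivalence; module ≡-Reasoning)
open import Relation.Binary.Structures using (IsStrictTotalOrder)
open import Relation.Nullary.Decidable using (Dec; yes; no; does; dec-true; decidable-stable)
open import Relation.Nullary.Negation using (¬_; contradiction)

-- Descent conditions as monotonicity on blocks.

Increasing : ∀ {n} → (Fin n → ℕ) → Set
Increasing f = ∀ {x y} → x ≤ y → f x ℕ.≤ f y

IncreasingOnFibres : ∀ {n} → (Fin n → ℕ) → (Fin n → Fin n) → Set
IncreasingOnFibres f π = ∀ {x y} → x < y → f x ≡ f y → π x < π y

-- The number of members of `I` before a position, so that the fibres are exactly the blocks cut out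
-- by `I`.
block : ∀ {m} → Subset m → Fin (suc m) → ℕ
block I             zero    = 0
block (inside  ∷ I) (suc x) = suc (block I x)
block (outside ∷ I) (suc x) = block I x

block-mono : ∀ {m} (I : Subset m) → Increasing (block I)
block-mono I             {zero}  {y}     _         = z≤n
block-mono (inside  ∷ I) {suc x} {suc y} (s≤s x≤y) = s≤s (block-mono I x≤y)
block-mono (outside ∷ I) {suc x} {suc y} (s≤s x≤y) = block-mono I x≤y

block-step : ∀ {m} (I : Subset m) {i} → i ∉ I → block I (inject₁ i) ≡ block I (suc i)
block-step (inside  ∷ I) {zero}  i∉I = contradiction here i∉I
block-step (outside ∷ I) {zero}  i∉I = refl
block-step (inside  ∷ I) {suc i} i∉I = cong suc (block-step I (i∉I ∘ there))
block-step (outside ∷ I) {suc i} i∉I = block-step I (i∉I ∘ there)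

-- Every step between neighbours inside a block avoids `I`, so the inequalities chain. Values in `ℕ`
-- make the tail `p ∘ suc` an instance again.
increasing-on-blocks : ∀ {m} (I : Subset m) (p : Fin (suc m) → ℕ) →
  (∀ {i} → i ∉ I → p (inject₁ i) ℕ.< p (suc i)) →
  ∀ {x y} → x < y → block I x ≡ block I y → p x ℕ.< p y
increasing-on-blocks (outside ∷ I) p step {zero}  {suc zero}    _   _  = step λ ()
increasing-on-blocks (outside ∷ I) p step {zero}  {suc (suc y)} _   eq = ℕ.<-trans (step λ ())
  (increasing-on-blocks I (p ∘ suc) (λ i∉I → step (i∉I ∘ drop-there)) {zero} {suc y} z<s eq)
increasing-on-blocks (inside  ∷ I) p step {suc x} {suc y} x<y eq =
  increasing-on-blocks I (p ∘ suc) (λ i∉I → step (i∉I ∘ drop-there)) (s<s⁻¹ x<y) (ℕ.suc-injective eq)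
increasing-on-blocks (outside ∷ I) p step {suc x} {suc y} x<y eq =
  increasing-on-blocks I (p ∘ suc) (λ i∉I → step (i∉I ∘ drop-there)) (s<s⁻¹ x<y) eq

inject₁<suc : ∀ {m} (i : Fin m) → inject₁ i < suc i
inject₁<suc i = s≤s (ℕ.≤-reflexive (toℕ-inject₁ i))

does-true⁻ : ∀ {p} {P : Set p} (P? : Dec P) → does P? ≡ true → P
does-true⁻ (yes p) _ = p

permutation-injective : ∀ {n} (π : Permutation′ n) → Injective _≡_ _≡_ (π ⟨$⟩ʳ_)
permutation-injective π = Injection.injective (↔⇒↣ π)

module _ {m} (I : Subset m) (π : Permutation′ (suc m)) where

  ∈D⁺ : ∀ {i} → π ⟨$⟩ʳ suc i < π ⟨$⟩ʳ inject₁ i → i ∈ D π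
  ∈D⁺ {i} i∈ = lookup⇒[]= i _ (trans (lookup∘tabulate _ i) (dec-true (_ <? _) i∈))

  ∈D⁻ : ∀ {i} → i ∈ D π → π ⟨$⟩ʳ suc i < π ⟨$⟩ʳ inject₁ i
  ∈D⁻ {i} i∈ = does-true⁻ (_ <? _) (trans (sym (lookup∘tabulate _ i)) ([]=⇒lookup i∈))

  D⊆⇒increasing : D π ⊆ I → IncreasingOnFibres (block I) (π ⟨$⟩ʳ_)
  D⊆⇒increasing D⊆I = increasing-on-blocks I (toℕ ∘ (π ⟨$⟩ʳ_)) step
    where
    step : ∀ {i} → i ∉ I → π ⟨$⟩ʳ inject₁ i < π ⟨$⟩ʳ suc i
    -- A non-descent gives only a weak inequality; injectivity of `π` makes it strict.
    step {i} i∉I = ≤∧≢⇒< (ℕ.≮⇒≥ (i∉I ∘ D⊆I ∘ ∈D⁺))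
      λ eq → ℕ.<⇒≢ (inject₁<suc i) (cong toℕ (permutation-injective π eq))

  increasing⇒D⊆ : IncreasingOnFibres (block I) (π ⟨$⟩ʳ_) → D π ⊆ I
  increasing⇒D⊆ inc {i} i∈D = decidable-stable (i ∈? I) λ i∉I →
    ℕ.<-asym (∈D⁻ i∈D) (inc (inject₁<suc i) (block-step I i∉I))

-- The associated composition by recursion on the subset.

differences-suc : ∀ n p is → differences (suc n) (suc p) (map suc is) ≡ differences n p is
differences-suc n p []       = refl
differences-suc n p (i ∷ is) = cong (i ∸ p ∷_) (differences-suc n i is)

-- The lower end stays at 0 while all other points move up by one, so only the first part grows.
differences-suc₀ : ∀ n is {a as} → differences n 0 is ≡ a ∷ as → differences (suc n) 0 (map suc is) ≡ suc a ∷ as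
differences-suc₀ n []       refl = refl
differences-suc₀ n (i ∷ is) refl = cong (suc i ∷_) (differences-suc n i is)

filter-map : ∀ {A B : Set} {P : B → Set} {Q : A → Set} (P? : ∀ b → Dec (P b)) (Q? : ∀ a → Dec (Q a)) (f : A → B) →
  (∀ a → P (f a) ⇔ Q a) → ∀ as → filter P? (map f as) ≡ map f (filter Q? as)
filter-map P? Q? f P⇔Q [] = refl
filter-map P? Q? f P⇔Q (a ∷ as) with IH ← filter-map P? Q? f P⇔Q as | P? (f a) | Q? a
... | yes _ | yes _ = cong (f a ∷_) IH
... | no  _ | no  _ = IH
... | yes p | no ¬q = contradiction (Equivalence.to (P⇔Q a) p) ¬q
... | no ¬p | yes q = contradiction (Equivalence.from (P⇔Q a) q) ¬p

-- `List.tabulate suc` is what remains of `allFin` once membership of the first position is decided;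
-- this is the recursive step for `elements`.
elements-tail : ∀ {m} s (I : Subset m) →
  map (ℕ.suc ∘ toℕ) (filter (_∈? (s ∷ I)) (List.tabulate suc)) ≡ map ℕ.suc (elements I)
elements-tail {m} s I = begin
  map (ℕ.suc ∘ toℕ) (filter (_∈? (s ∷ I)) (List.tabulate suc))
    ≡⟨ cong (map (ℕ.suc ∘ toℕ) ∘ filter (_∈? (s ∷ I))) (map-tabulate id Fin.suc) ⟨
  map (ℕ.suc ∘ toℕ) (filter (_∈? (s ∷ I)) (map Fin.suc (allFin m)))
    ≡⟨ cong (map (ℕ.suc ∘ toℕ)) (filter-map (_∈? (s ∷ I)) (_∈? I) Fin.suc (λ _ → mk⇔ drop-there there) (allFin m)) ⟩
  map (ℕ.suc ∘ toℕ) (map Fin.suc (filter (_∈? I) (allFin m)))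
    ≡⟨ map-∘ (filter (_∈? I) (allFin m)) ⟨
  map (ℕ.suc ∘ ℕ.suc ∘ toℕ) (filter (_∈? I) (allFin m))
    ≡⟨ map-∘ (filter (_∈? I) (allFin m)) ⟩
  map ℕ.suc (elements I) ∎
  where open ≡-Reasoning

-- Kept apart from `otherParts` because a composition of a positive number always has a first part,
-- and an `outside` extends just that part.
firstPart : ∀ {m} → Subset m → ℕ
firstPart []            = 1
firstPart (inside ∷ I)  = 1
firstPart (outside ∷ I) = suc (firstPart I)

otherParts : ∀ {m} → Subset m → List ℕ
otherParts []            = []
otherParts (inside ∷ I)  = firstPart I ∷ otherParts I
otherParts (outside ∷ I) = otherParts I

associatedComposition-parts : ∀ {m} (I : Subset m) → associatedComposition I ≡ firstPart I ∷ otherParts I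
associatedComposition-parts []                    = refl
associatedComposition-parts {suc m} (inside ∷ I)  rewrite elements-tail inside I =
  cong (1 ∷_) (trans (differences-suc (suc m) 0 (elements I)) (associatedComposition-parts I))
associatedComposition-parts {suc m} (outside ∷ I) rewrite elements-tail outside I =
  differences-suc₀ (suc m) (elements I) (associatedComposition-parts I)

-- Bijections that match the blocks of two subsets.

Cells : List ℕ → Set
Cells []       = Empty.⊥
Cells (a ∷ as) = Fin a ⊎ Cells as

part : ∀ as → Cells as → ℕ
part (a ∷ as) (inj₁ _) = 0
part (a ∷ as) (inj₂ u) = suc (part as u)

-- The renaming of labels stays implicit: equal labels on one side must correspond to equal labels
-- on the other, while the labels themselves may differ.
record FibreBijection {A B : Set} (f : A → ℕ) (g : B → ℕ) : Set where
  field
    bijection : A ↔ B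
  open Inverse bijection public using (to; from; strictlyInverseˡ; strictlyInverseʳ)
  field
    same-fibre : ∀ x y → f x ≡ f y ⇔ g (to x) ≡ g (to y)

open FibreBijection

≡⇒⇔ : {A B : Set} → A ≡ B → A ⇔ B
≡⇒⇔ refl = ⇔-refl

FibreBijection-trans : ∀ {A B C : Set} {f : A → ℕ} {g : B → ℕ} {h : C → ℕ} →
  FibreBijection f g → FibreBijection g h → FibreBijection f h
FibreBijection-trans φ ψ = record
  { bijection  = ↔-trans (bijection φ) (bijection ψ)
  ; same-fibre = λ x y → ⇔-trans (same-fibre φ x y) (same-fibre ψ (to φ x) (to φ y))
  }

FibreBijection-sym : ∀ {A B : Set} {f : A → ℕ} {g : B → ℕ} → FibreBijection f g → FibreBijection g f
FibreBijection-sym {g = g} φ = record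
  { bijection  = ↔-sym (bijection φ)
  ; same-fibre = λ x y → ⇔-trans
      (≡⇒⇔ (cong₂ (λ u v → g u ≡ g v) (sym (strictlyInverseˡ φ x)) (sym (strictlyInverseˡ φ y))))
      (⇔-sym (same-fibre φ (from φ x) (from φ y)))
  }

suc-⇔ : ∀ {a b c d : ℕ} → a ≡ b ⇔ c ≡ d → suc a ≡ suc b ⇔ suc c ≡ suc d
suc-⇔ eqv = mk⇔ (cong suc ∘ Equivalence.to eqv ∘ ℕ.suc-injective) (cong suc ∘ Equivalence.from eqv ∘ ℕ.suc-injective)

-- A permutation of the parts permutes the summands of `Cells` and leaves the inside of each summand
-- alone.
Cells-↭ : ∀ {as bs} → as ↭ bs → FibreBijection (part as) (part bs)
Cells-↭ ↭.refl = record { bijection = ↔-refl ; same-fibre = λ _ _ → ⇔-refl }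
Cells-↭ (↭.prep a p) with φ ← Cells-↭ p = record
  { bijection  = ↔-refl ⊎-↔ bijection φ
  ; same-fibre = λ where
      (inj₁ _) (inj₁ _) → mk⇔ (λ _ → refl) (λ _ → refl)
      (inj₁ _) (inj₂ _) → mk⇔ (λ ()) (λ ())
      (inj₂ _) (inj₁ _) → mk⇔ (λ ()) (λ ())
      (inj₂ u) (inj₂ v) → suc-⇔ (same-fibre φ u v)
  }
Cells-↭ (↭.swap a b p) with φ ← Cells-↭ p = record
  { bijection  = mk↔ₛ′ (exchange (to φ)) (exchange (from φ))
                   (exchange-inverse (strictlyInverseˡ φ)) (exchange-inverse (strictlyInverseʳ φ))
  ; same-fibre = λ where
      (inj₁ _)        (inj₁ _)        → mk⇔ (λ _ → refl) (λ _ → refl)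
      (inj₁ _)        (inj₂ (inj₁ _)) → mk⇔ (λ ()) (λ ())
      (inj₁ _)        (inj₂ (inj₂ _)) → mk⇔ (λ ()) (λ ())
      (inj₂ (inj₁ _)) (inj₁ _)        → mk⇔ (λ ()) (λ ())
      (inj₂ (inj₁ _)) (inj₂ (inj₁ _)) → mk⇔ (λ _ → refl) (λ _ → refl)
      (inj₂ (inj₁ _)) (inj₂ (inj₂ _)) → mk⇔ (λ ()) (λ ())
      (inj₂ (inj₂ _)) (inj₁ _)        → mk⇔ (λ ()) (λ ())
      (inj₂ (inj₂ _)) (inj₂ (inj₁ _)) → mk⇔ (λ ()) (λ ())
      (inj₂ (inj₂ u)) (inj₂ (inj₂ v)) → suc-⇔ (suc-⇔ (same-fibre φ u v))
  }
  where
  exchange : ∀ {A B C D : Set} → (C → D) → A ⊎ B ⊎ C → B ⊎ A ⊎ D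
  exchange h (inj₁ x)        = inj₂ (inj₁ x)
  exchange h (inj₂ (inj₁ x)) = inj₁ x
  exchange h (inj₂ (inj₂ x)) = inj₂ (inj₂ (h x))

  exchange-inverse : ∀ {A B C D : Set} {h : C → D} {k : D → C} → (∀ x → h (k x) ≡ x) →
    ∀ (x : A ⊎ B ⊎ D) → exchange h (exchange k x) ≡ x
  exchange-inverse hk (inj₁ x)        = refl
  exchange-inverse hk (inj₂ (inj₁ x)) = refl
  exchange-inverse hk (inj₂ (inj₂ x)) = cong (inj₂ ∘ inj₂) (hk x)
Cells-↭ (↭.trans p q) = FibreBijection-trans (Cells-↭ p) (Cells-↭ q)

-- The summand records the block of a position, the index in it the offset from the start of the
-- block.
cell : ∀ {m} (I : Subset m) → Fin (suc m) → Cells (firstPart I ∷ otherParts I)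
cell []            zero    = inj₁ zero
cell (inside ∷ I)  zero    = inj₁ zero
cell (inside ∷ I)  (suc x) = inj₂ (cell I x)
cell (outside ∷ I) zero    = inj₁ zero
cell (outside ∷ I) (suc x) = map₁ suc (cell I x)

position : ∀ {m} (I : Subset m) → Cells (firstPart I ∷ otherParts I) → Fin (suc m)
position []            _              = zero
position (inside ∷ I)  (inj₁ _)       = zero
position (inside ∷ I)  (inj₂ u)       = suc (position I u)
position (outside ∷ I) (inj₁ zero)    = zero
position (outside ∷ I) (inj₁ (suc j)) = suc (position I (inj₁ j))
position (outside ∷ I) (inj₂ u)       = suc (position I (inj₂ u))

cell-position : ∀ {m} (I : Subset m) u → cell I (position I u) ≡ u
cell-position []            (inj₁ zero)    = refl
cell-position (inside ∷ I)  (inj₁ zero)    = refl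
cell-position (inside ∷ I)  (inj₂ u)       = cong inj₂ (cell-position I u)
cell-position (outside ∷ I) (inj₁ zero)    = refl
cell-position (outside ∷ I) (inj₁ (suc j)) = cong (map₁ suc) (cell-position I (inj₁ j))
cell-position (outside ∷ I) (inj₂ u)       = cong (map₁ suc) (cell-position I (inj₂ u))

position-map₁-suc : ∀ {m} (I : Subset m) u → position (outside ∷ I) (map₁ suc u) ≡ suc (position I u)
position-map₁-suc I (inj₁ _) = refl
position-map₁-suc I (inj₂ _) = refl

position-cell : ∀ {m} (I : Subset m) x → position I (cell I x) ≡ x
position-cell []            zero    = refl
position-cell (inside ∷ I)  zero    = refl
position-cell (inside ∷ I)  (suc x) = cong suc (position-cell I x)
position-cell (outside ∷ I) zero    = refl
position-cell (outside ∷ I) (suc x) =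
  trans (position-map₁-suc I (cell I x)) (cong suc (position-cell I x))

part-map₁ : ∀ {a b as} (h : Fin a → Fin b) u → part (b ∷ as) (map₁ h u) ≡ part (a ∷ as) u
part-map₁ h (inj₁ _) = refl
part-map₁ h (inj₂ _) = refl

part-cell : ∀ {m} (I : Subset m) x → part (firstPart I ∷ otherParts I) (cell I x) ≡ block I x
part-cell []            zero    = refl
part-cell (inside ∷ I)  zero    = refl
part-cell (inside ∷ I)  (suc x) = cong suc (part-cell I x)
part-cell (outside ∷ I) zero    = refl
part-cell (outside ∷ I) (suc x) = trans (part-map₁ suc (cell I x)) (part-cell I x)

block-Cells : ∀ {m} (I : Subset m) → FibreBijection (block I) (part (associatedComposition I))
block-Cells I rewrite associatedComposition-parts I = record
  { bijection  = mk↔ₛ′ (cell I) (position I) (cell-position I) (position-cell I)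
  ; same-fibre = λ x y → ≡⇒⇔ (cong₂ _≡_ (sym (part-cell I x)) (sym (part-cell I y)))
  }

block-↭ : ∀ {m} (I J : Subset m) → associatedComposition I ↭ associatedComposition J →
  FibreBijection (block I) (block J)
block-↭ I J p = FibreBijection-trans (block-Cells I)
  (FibreBijection-trans (Cells-↭ p) (FibreBijection-sym (block-Cells J)))

-- Partitions as sorted lists.

sortDescending-↭ : ∀ {xs ys} → xs ↭ ys → sortDescending xs ≡ sortDescending ys
sortDescending-↭ {xs} {ys} xs↭ys = Pointwise-≡⇒≡
  (↗↭↗⇒≋ (DecTotalOrder.totalOrder ≥-decTotalOrder) (sort-↗ xs) (sort-↗ ys)
    (↭⇒↭ₛ (↭-trans (sort-↭ xs) (↭-trans xs↭ys (↭-sym (sort-↭ ys))))))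

sortDescending-injective : ∀ {xs ys} → sortDescending xs ≡ sortDescending ys → xs ↭ ys
sortDescending-injective {xs} {ys} eq =
  ↭-trans (↭-sym (sort-↭ xs)) (↭-trans (↭-reflexive eq) (sort-↭ ys))

-- Invariance of the cycle structure under conjugation.

module _ {n : ℕ} where

  ∈-⋃⁺ : ∀ {x : Fin n} {xs} → x ∈ˡ xs → x ∈ ⋃ (map ⁅_⁆ xs)
  ∈-⋃⁺ {xs = y ∷ _} (here refl) = x∈p∪q⁺ {p = ⁅ y ⁆} (inj₁ (x∈⁅x⁆ y))
  ∈-⋃⁺ {xs = y ∷ _} (there x∈xs) = x∈p∪q⁺ {p = ⁅ y ⁆} (inj₂ (∈-⋃⁺ x∈xs))

  ∈-⋃⁻ : ∀ {x : Fin n} xs → x ∈ ⋃ (map ⁅_⁆ xs) → x ∈ˡ xs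
  ∈-⋃⁻ []       x∈⊥ = contradiction x∈⊥ ∉⊥
  ∈-⋃⁻ (y ∷ xs) x∈  with x∈p∪q⁻ ⁅ y ⁆ _ x∈
  ... | inj₁ x∈⁅y⁆ = here (x∈⁅y⁆⇒x≡y y x∈⁅y⁆)
  ... | inj₂ x∈xs  = there (∈-⋃⁻ xs x∈xs)

-- As a sum over all points, the cardinality is visibly invariant under a permutation of the points.
∣p∣≡sum : ∀ {n} (p : Subset n) → ∣ p ∣ ≡ sum (λ i → if lookup p i then 1 else 0)
∣p∣≡sum []            = refl
∣p∣≡sum (inside ∷ p)  = cong suc (∣p∣≡sum p)
∣p∣≡sum (outside ∷ p) = ∣p∣≡sum p

module _ {n : ℕ} (r : Permutation′ n) where

  image : Subset n → Subset n
  image p = tabulate (λ y → lookup p (r ⟨$⟩ˡ y))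

  lookup-image : ∀ p x → lookup (image p) (r ⟨$⟩ʳ x) ≡ lookup p x
  lookup-image p x = trans (lookup∘tabulate _ (r ⟨$⟩ʳ x)) (cong (lookup p) (inverseˡ r))

  image-injective : ∀ {p q} → image p ≡ image q → p ≡ q
  image-injective {p} {q} eq = begin
    p                    ≡⟨ tabulate∘lookup p ⟨
    tabulate (lookup p)  ≡⟨ tabulate-cong (λ x → trans (sym (lookup-image p x))
                              (trans (cong (λ s → lookup s (r ⟨$⟩ʳ x)) eq) (lookup-image q x))) ⟩
    tabulate (lookup q)  ≡⟨ tabulate∘lookup q ⟩
    q                    ∎
    where open ≡-Reasoning

  ∣image∣ : ∀ p → ∣ image p ∣ ≡ ∣ p ∣
  ∣image∣ p = begin
    ∣ image p ∣                                                   ≡⟨ ∣p∣≡sum (image p) ⟩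
    sum (λ i → if lookup (image p) i then 1 else 0)               ≡⟨ sum-permute _ r ⟩
    sum (λ i → if lookup (image p) (r ⟨$⟩ʳ i) then 1 else 0)      ≡⟨ sum-cong-≗ (λ i →
                                                                       cong (if_then 1 else 0) (lookup-image p i)) ⟩
    sum (λ i → if lookup p i then 1 else 0)                       ≡⟨ ∣p∣≡sum p ⟨
    ∣ p ∣                                                         ∎
    where open ≡-Reasoning

  ∈-image⁺ : ∀ {p x} → x ∈ p → r ⟨$⟩ʳ x ∈ image p
  ∈-image⁺ {p} {x} x∈p = lookup⇒[]= _ _ (trans (lookup-image p x) ([]=⇒lookup x∈p))

  ∈-image⁻ : ∀ {p y} → y ∈ image p → r ⟨$⟩ˡ y ∈ p
  ∈-image⁻ {p} {y} y∈ = lookup⇒[]= _ _ (trans (sym (lookup∘tabulate _ y)) ([]=⇒lookup y∈))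

  image-⋃ : ∀ xs → image (⋃ (map ⁅_⁆ xs)) ≡ ⋃ (map ⁅_⁆ (map (r ⟨$⟩ʳ_) xs))
  image-⋃ xs = ⊆-antisym
    (λ y∈ → ∈-⋃⁺ (subst (_∈ˡ map (r ⟨$⟩ʳ_) xs) (inverseʳ r) (∈-map⁺ (r ⟨$⟩ʳ_) (∈-⋃⁻ xs (∈-image⁻ y∈)))))
    (λ y∈ → let x , x∈xs , y≡rx = ∈-map⁻ (r ⟨$⟩ʳ_) (∈-⋃⁻ (map (r ⟨$⟩ʳ_) xs) y∈) in
      subst (_∈ image (⋃ (map ⁅_⁆ xs))) (sym y≡rx) (∈-image⁺ (∈-⋃⁺ x∈xs)))

  conjugate : Permutation′ n → Permutation′ n
  conjugate π = flip r ∘ₚ π ∘ₚ r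

  module _ (π : Permutation′ n) where

    conjugate-image : ∀ x → conjugate π ⟨$⟩ʳ (r ⟨$⟩ʳ x) ≡ r ⟨$⟩ʳ (π ⟨$⟩ʳ x)
    conjugate-image x = cong (λ z → r ⟨$⟩ʳ (π ⟨$⟩ʳ z)) (inverseˡ r)

    iterate-conjugate : ∀ x k →
      List.iterate (conjugate π ⟨$⟩ʳ_) (r ⟨$⟩ʳ x) k ≡ map (r ⟨$⟩ʳ_) (List.iterate (π ⟨$⟩ʳ_) x k)
    iterate-conjugate x zero    = refl
    iterate-conjugate x (suc k) = cong (r ⟨$⟩ʳ x ∷_)
      (trans (cong (λ z → List.iterate (conjugate π ⟨$⟩ʳ_) z k) (conjugate-image x)) (iterate-conjugate (π ⟨$⟩ʳ x) k))

    cycleOf-conjugate : ∀ x → cycleOf (conjugate π) (r ⟨$⟩ʳ x) ≡ image (cycleOf π x)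
    cycleOf-conjugate x = trans
      (cong (⋃ ∘ map ⁅_⁆) (iterate-conjugate x n))
      (sym (image-⋃ (List.iterate (π ⟨$⟩ʳ_) x n)))

    -- Both lists are free of duplicates and have the same members. Their orders may differ, since
    -- `r` changes which cycle is met first.
    cycles-conjugate : cycles (conjugate π) ↭ map image (cycles π)
    cycles-conjugate = ∼bag⇒↭ (unique∧set⇒bag
      (DecUnique.deduplicate-! (≡-dec _≟ᵇ_) _)
      (Unique.map⁺ image-injective (DecUnique.deduplicate-! (≡-dec _≟ᵇ_) _))
      (mk⇔ forth back))
      where
      cycle∈ : ∀ σ x → cycleOf σ x ∈ˡ cycles σ
      cycle∈ σ x = ∈-deduplicate⁺ (≡-dec _≟ᵇ_) (∈-map⁺ (cycleOf σ) (∈-allFin x))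

      ∈cycles : ∀ σ {p} → p ∈ˡ cycles σ → ∃[ x ] p ≡ cycleOf σ x
      ∈cycles σ p∈
        with x , _ , eq ← ∈-map⁻ (cycleOf σ) (∈-deduplicate⁻ (≡-dec _≟ᵇ_) (map (cycleOf σ) (allFin n)) p∈)
        = x , eq

      forth : ∀ {p} → p ∈ˡ cycles (conjugate π) → p ∈ˡ map image (cycles π)
      forth p∈ with y , refl ← ∈cycles (conjugate π) p∈ =
        subst (_∈ˡ map image (cycles π))
          (trans (sym (cycleOf-conjugate (r ⟨$⟩ˡ y))) (cong (cycleOf (conjugate π)) (inverseʳ r)))
          (∈-map⁺ image (cycle∈ π (r ⟨$⟩ˡ y)))

      back : ∀ {p} → p ∈ˡ map image (cycles π) → p ∈ˡ cycles (conjugate π)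
      back p∈ with q , q∈ , refl ← ∈-map⁻ image p∈ with x , refl ← ∈cycles π q∈ =
        subst (_∈ˡ cycles (conjugate π)) (cycleOf-conjugate x) (cycle∈ (conjugate π) (r ⟨$⟩ʳ x))

    cycleStructure-conjugate : cycleStructure (conjugate π) ≡ cycleStructure π
    cycleStructure-conjugate = trans
      (sortDescending-↭ (↭-map⁺ ∣_∣ cycles-conjugate))
      (cong sortDescending (trans (sym (map-∘ (cycles π))) (map-cong ∣image∣ (cycles π))))

-- Uniqueness of increasing rearrangements.

-- Injectivity of ρ yields some j ≤ x with x ≤ ρ j, so that f x ≥ f j = g (ρ j) ≥ g x.
rearrangement-≤ : ∀ {n} {f g : Fin n → ℕ} → Increasing f → Increasing g →
  (ρ : Permutation′ n) → (∀ x → f x ≡ g (ρ ⟨$⟩ʳ x)) → ∀ x → g x ℕ.≤ f x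
rearrangement-≤ {f = f} {g} f-inc g-inc ρ f≡gρ x
  with j , j≤x , x≤ρj ← injective⇒existsPivot (permutation-injective ρ) x = begin
  g x            ≤⟨ g-inc x≤ρj ⟩
  g (ρ ⟨$⟩ʳ j)   ≡⟨ f≡gρ j ⟨
  f j            ≤⟨ f-inc j≤x ⟩
  f x            ∎
  where open ℕ.≤-Reasoning

-- The two inequalities come from `ρ` and from its inverse.
increasing-rearrangement : ∀ {n} {f g : Fin n → ℕ} → Increasing f → Increasing g →
  (ρ : Permutation′ n) → (∀ x → f x ≡ g (ρ ⟨$⟩ʳ x)) → ∀ x → f x ≡ g x
increasing-rearrangement {g = g} f-inc g-inc ρ f≡gρ x = ℕ.≤-antisym
  (rearrangement-≤ g-inc f-inc (flip ρ) (λ y → trans (cong g (sym (inverseʳ ρ))) (sym (f≡gρ (ρ ⟨$⟩ˡ y)))) x)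
  (rearrangement-≤ f-inc g-inc ρ f≡gρ x)

<-preserving⇒≤-preserving : ∀ {n} (σ : Fin n → Fin n) → (∀ {x y} → x < y → σ x < σ y) → Increasing (toℕ ∘ σ)
<-preserving⇒≤-preserving σ σ-mono {x} {y} x≤y with ℕ.m≤n⇒m<n∨m≡n x≤y
... | inj₁ x<y = ℕ.<⇒≤ (σ-mono x<y)
... | inj₂ x≡y = ℕ.≤-reflexive (cong (toℕ ∘ σ) (toℕ-injective x≡y))

-- The permutation `υ`, which is `τ` after the inverse of `σ`, is increasing. It is thus an
-- increasing rearrangement of the identity, hence the identity.
order-preserving-≈ : ∀ {n} (σ τ : Permutation′ n) →
  (∀ {x y} → σ ⟨$⟩ʳ x < σ ⟨$⟩ʳ y → τ ⟨$⟩ʳ x < τ ⟨$⟩ʳ y) → σ ≈ τ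
order-preserving-≈ σ τ mono x = sym (trans (cong (τ ⟨$⟩ʳ_) (sym (inverseˡ σ))) (toℕ-injective
  (increasing-rearrangement
    (<-preserving⇒≤-preserving (υ ⟨$⟩ʳ_) λ x<y → mono (subst₂ _<_ (sym (inverseʳ σ)) (sym (inverseʳ σ)) x<y))
    (λ x≤y → x≤y) υ (λ _ → refl) (σ ⟨$⟩ʳ x))))
  where υ = flip σ ∘ₚ τ

-- Ranking a finite strict total order.

injective⇒surjective : ∀ {n} {f : Fin n → Fin n} → Injective _≡_ _≡_ f → ∀ y → ∃[ x ] f x ≡ y
injective⇒surjective {suc n} {f} f-inj y with any? (λ x → f x ≟ y)
... | yes found = found
-- Punching the missed value `y` out of the codomain would leave an injection from `Fin (suc n)`
-- into `Fin n`.
... | no  ∄x    = contradiction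
  (injective⇒≤ {f = λ x → punchOut (y≢f x)} (λ eq → f-inj (punchOut-injective (y≢f _) (y≢f _) eq)))
  ℕ.1+n≰n
  where
  y≢f : ∀ x → y ≢ f x
  y≢f x eq = ∄x (x , sym eq)

module Rank {n} {_≺_ : Rel (Fin n) 0ℓ} (isSTO : IsStrictTotalOrder _≡_ _≺_) where
  private module S = IsStrictTotalOrder isSTO

  below : Fin n → Subset n
  below x = tabulate (λ y → does (y S.<? x))

  ∈-below⁺ : ∀ {x y} → y ≺ x → y ∈ below x
  ∈-below⁺ {x} {y} y≺x = lookup⇒[]= y _ (trans (lookup∘tabulate _ y) (dec-true (y S.<? x) y≺x))

  ∈-below⁻ : ∀ {x y} → y ∈ below x → y ≺ x
  ∈-below⁻ {x} {y} y∈ = does-true⁻ (y S.<? x) (trans (sym (lookup∘tabulate _ y)) ([]=⇒lookup y∈))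

  -- `x` is missing from `below x`, so the count is a valid index.
  ∣below∣<n : ∀ x → ∣ below x ∣ ℕ.< n
  ∣below∣<n x = subst (∣ below x ∣ ℕ.<_) (∣⊤∣≡n n)
    (p⊂q⇒∣p∣<∣q∣ ((λ _ → ∈⊤) , x , ∈⊤ , S.irrefl refl ∘ ∈-below⁻))

  rank : Fin n → Fin n
  rank x = fromℕ< (∣below∣<n x)

  -- The inclusion of `below x` in `below y` is strict, as `x` belongs only to the latter.
  rank-mono : ∀ {x y} → x ≺ y → rank x < rank y
  rank-mono {x} {y} x≺y = subst₂ ℕ._<_ (sym (toℕ-fromℕ< (∣below∣<n x))) (sym (toℕ-fromℕ< (∣below∣<n y)))
    (p⊂q⇒∣p∣<∣q∣ ((λ z∈ → ∈-below⁺ (S.trans (∈-below⁻ z∈) x≺y)) , x , ∈-below⁺ x≺y , S.irrefl refl ∘ ∈-below⁻))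

  rank-reflects : ∀ {x y} → rank x < rank y → x ≺ y
  rank-reflects {x} {y} rx<ry with S.compare x y
  ... | tri< x≺y _ _  = x≺y
  ... | tri≈ _ refl _ = contradiction rx<ry (ℕ.<-irrefl refl)
  ... | tri> _ _ y≺x  = contradiction rx<ry (ℕ.<-asym (rank-mono y≺x))

  rank-injective : Injective _≡_ _≡_ rank
  rank-injective {x} {y} eq with S.compare x y
  ... | tri< x≺y _ _ = contradiction (cong toℕ eq) (ℕ.<⇒≢ (rank-mono x≺y))
  ... | tri≈ _ x≡y _ = x≡y
  ... | tri> _ _ y≺x = contradiction (cong toℕ (sym eq)) (ℕ.<⇒≢ (rank-mono y≺x))

  rankₚ : Permutation′ n
  rankₚ = permutation rank (proj₁ ∘ surj) (proj₂ ∘ surj) (λ x → rank-injective (proj₂ (surj (rank x))))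
    where surj = injective⇒surjective rank-injective

-- The lexicographic order of label words, with ties broken by position.

iterate-+ : ∀ {A : Set} (f : A → A) x j k → iterate f x (j + k) ≡ iterate f (iterate f x j) k
iterate-+ f x zero    k = refl
iterate-+ f x (suc j) k = iterate-+ f (f x) j k

-- _⊏_ is the strict lexicographic order on the infinite words c x, c (π x), c (π² x), …
module Words {n} (c : Fin n → ℕ) (π : Fin n → Fin n) where

  data _⊏_ : Rel (Fin n) 0ℓ where
    here  : ∀ {x y} → c x ℕ.< c y → x ⊏ y
    there : ∀ {x y} → c x ≡ c y → π x ⊏ π y → x ⊏ y

  _≋_ : Rel (Fin n) 0ℓ
  x ≋ y = ∀ k → c (iterate π x k) ≡ c (iterate π y k)

  _≺_ : Rel (Fin n) 0ℓ
  x ≺ y = x ⊏ y ⊎ (x ≋ y × x < y)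

  ⊏-trans : ∀ {x y z} → x ⊏ y → y ⊏ z → x ⊏ z
  ⊏-trans (here  x<y)     (here  y<z)     = here (ℕ.<-trans x<y y<z)
  ⊏-trans (here  x<y)     (there y≡z _)   = here (ℕ.<-≤-trans x<y (ℕ.≤-reflexive y≡z))
  ⊏-trans (there x≡y _)   (here  y<z)     = here (ℕ.≤-<-trans (ℕ.≤-reflexive x≡y) y<z)
  ⊏-trans (there x≡y x⊏y) (there y≡z y⊏z) = there (trans x≡y y≡z) (⊏-trans x⊏y y⊏z)

  ⊏-respʳ-≋ : ∀ {x y z} → y ≋ z → x ⊏ y → x ⊏ z
  ⊏-respʳ-≋ y≋z (here  x<y)     = here (ℕ.<-≤-trans x<y (ℕ.≤-reflexive (y≋z 0)))
  ⊏-respʳ-≋ y≋z (there x≡y x⊏y) = there (trans x≡y (y≋z 0)) (⊏-respʳ-≋ (y≋z ∘ suc) x⊏y)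

  ⊏-respˡ-≋ : ∀ {x y z} → x ≋ y → y ⊏ z → x ⊏ z
  ⊏-respˡ-≋ x≋y (here  y<z)     = here (ℕ.≤-<-trans (ℕ.≤-reflexive (x≋y 0)) y<z)
  ⊏-respˡ-≋ x≋y (there y≡z y⊏z) = there (trans (x≋y 0) y≡z) (⊏-respˡ-≋ (x≋y ∘ suc) y⊏z)

  ⊏-irrefl : ∀ {x y} → x ≋ y → ¬ (x ⊏ y)
  ⊏-irrefl x≋y (here  x<y)   = ℕ.<⇒≢ x<y (x≋y 0)
  ⊏-irrefl x≋y (there _ x⊏y) = ⊏-irrefl (x≋y ∘ suc) x⊏y

  ≺-trans : ∀ {x y z} → x ≺ y → y ≺ z → x ≺ z
  ≺-trans (inj₁ x⊏y)         (inj₁ y⊏z)         = inj₁ (⊏-trans x⊏y y⊏z)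
  ≺-trans (inj₁ x⊏y)         (inj₂ (y≋z , _))   = inj₁ (⊏-respʳ-≋ y≋z x⊏y)
  ≺-trans (inj₂ (x≋y , _))   (inj₁ y⊏z)         = inj₁ (⊏-respˡ-≋ x≋y y⊏z)
  ≺-trans (inj₂ (x≋y , x<y)) (inj₂ (y≋z , y<z)) = inj₂ ((λ k → trans (x≋y k) (y≋z k)) , ℕ.<-trans x<y y<z)

  ≺-irrefl : ∀ {x} → ¬ (x ≺ x)
  ≺-irrefl (inj₁ x⊏x)       = ⊏-irrefl (λ _ → refl) x⊏x
  ≺-irrefl (inj₂ (_ , x<x)) = ℕ.<-irrefl refl x<x

  AgreeBelow : ℕ → Rel (Fin n) 0ℓ
  AgreeBelow k x y = ∀ {l} → l ℕ.< k → c (iterate π x l) ≡ c (iterate π y l)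

  agree-suc : ∀ {k x y} → c x ≡ c y → AgreeBelow k (π x) (π y) → AgreeBelow (suc k) x y
  agree-suc x≡y agree {zero}  _   = x≡y
  agree-suc x≡y agree {suc l} l<k = agree (ℕ.s<s⁻¹ l<k)

  -- The pair of orbits revisits a state within n * n steps.
  agree-forever : ∀ {x y} → AgreeBelow (suc (n * n)) x y → x ≋ y
  agree-forever {x} {y} agree
    with i , j , i<j , eq ← pigeonhole (ℕ.n<1+n (n * n)) (λ k → combine (iterate π x (toℕ k)) (iterate π y (toℕ k)))
    with eqˣ , eqʸ ← combine-injective (iterate π x (toℕ i)) (iterate π y (toℕ i)) _ _ eq
    = <-rec _ step
    where
    jump : ∀ z → iterate π z (toℕ i) ≡ iterate π z (toℕ j) →
      ∀ {k} → toℕ j ℕ.≤ k → iterate π z k ≡ iterate π z (toℕ i + (k ∸ toℕ j))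
    jump z eq {k} j≤k = begin
      iterate π z k                                  ≡⟨ cong (iterate π z) (ℕ.m+[n∸m]≡n j≤k) ⟨
      iterate π z (toℕ j + (k ∸ toℕ j))              ≡⟨ iterate-+ π z (toℕ j) _ ⟩
      iterate π (iterate π z (toℕ j)) (k ∸ toℕ j)    ≡⟨ cong (λ w → iterate π w (k ∸ toℕ j)) eq ⟨
      iterate π (iterate π z (toℕ i)) (k ∸ toℕ j)    ≡⟨ iterate-+ π z (toℕ i) _ ⟨
      iterate π z (toℕ i + (k ∸ toℕ j))              ∎
      where open ≡-Reasoning

    step : ∀ k → AgreeBelow k x y → c (iterate π x k) ≡ c (iterate π y k)
    step k earlier with k ℕ.≤? n * n
    ... | yes k≤ = agree (ℕ.s≤s k≤)
    -- Beyond `n * n`, trading `j` for `i` in the index leaves both letters unchanged and leads to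
    -- an earlier index, because `i` is less than `j`.
    ... | no  k≰ = begin
      c (iterate π x k)                      ≡⟨ cong c (jump x eqˣ j≤k) ⟩
      c (iterate π x (toℕ i + (k ∸ toℕ j)))  ≡⟨ earlier (ℕ.<-≤-trans (ℕ.+-monoˡ-< _ i<j) (ℕ.≤-reflexive (ℕ.m+[n∸m]≡n j≤k))) ⟩
      c (iterate π y (toℕ i + (k ∸ toℕ j)))  ≡⟨ cong c (jump y eqʸ j≤k) ⟨
      c (iterate π y k)                      ∎
      where
      open ≡-Reasoning
      j≤k : toℕ j ℕ.≤ k
      j≤k = ℕ.≤-trans (ℕ.s≤s⁻¹ (toℕ<n j)) (ℕ.<⇒≤ (ℕ.≰⇒> k≰))

  compareUpTo : ∀ k x y → x ⊏ y ⊎ AgreeBelow k x y ⊎ y ⊏ x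
  compareUpTo zero    x y = inj₂ (inj₁ λ ())
  compareUpTo (suc k) x y with ℕ.<-cmp (c x) (c y)
  ... | tri< x<y _ _ = inj₁ (here x<y)
  ... | tri> _ _ y<x = inj₂ (inj₂ (here y<x))
  ... | tri≈ _ x≡y _ with compareUpTo k (π x) (π y)
  ...   | inj₁ x⊏y          = inj₁ (there x≡y x⊏y)
  ...   | inj₂ (inj₂ y⊏x)   = inj₂ (inj₂ (there (sym x≡y) y⊏x))
  ...   | inj₂ (inj₁ agree) = inj₂ (inj₁ (agree-suc x≡y agree))

  -- Infinite words become comparable because agreement on `suc (n * n)` letters forces agreement
  -- everywhere.
  compareWords : ∀ x y → x ⊏ y ⊎ x ≋ y ⊎ y ⊏ x
  compareWords x y with compareUpTo (suc (n * n)) x y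
  ... | inj₁ x⊏y          = inj₁ x⊏y
  ... | inj₂ (inj₂ y⊏x)   = inj₂ (inj₂ y⊏x)
  ... | inj₂ (inj₁ agree) = inj₂ (inj₁ (agree-forever agree))

  ≺-compare : Trichotomous _≡_ _≺_
  ≺-compare x y with <-cmp x y | compareWords x y
  ... | tri≈ _ refl _ | _                 = tri≈ ≺-irrefl refl ≺-irrefl
  ... | tri< _ x≢y _  | inj₁ x⊏y          = tri< (inj₁ x⊏y) x≢y (≺-irrefl ∘ ≺-trans (inj₁ x⊏y))
  ... | tri> _ x≢y _  | inj₁ x⊏y          = tri< (inj₁ x⊏y) x≢y (≺-irrefl ∘ ≺-trans (inj₁ x⊏y))
  ... | tri< _ x≢y _  | inj₂ (inj₂ y⊏x)   = tri> (≺-irrefl ∘ ≺-trans (inj₁ y⊏x)) x≢y (inj₁ y⊏x)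
  ... | tri> _ x≢y _  | inj₂ (inj₂ y⊏x)   = tri> (≺-irrefl ∘ ≺-trans (inj₁ y⊏x)) x≢y (inj₁ y⊏x)
  ... | tri< x<y x≢y _ | inj₂ (inj₁ x≋y)  =
    let x≺y = inj₂ (x≋y , x<y) in tri< x≺y x≢y (≺-irrefl ∘ ≺-trans x≺y)
  ... | tri> _ x≢y y<x | inj₂ (inj₁ x≋y)  =
    let y≺x = inj₂ (sym ∘ x≋y , y<x) in tri> (≺-irrefl ∘ ≺-trans y≺x) x≢y y≺x

  ≺-isStrictTotalOrder : IsStrictTotalOrder _≡_ _≺_
  ≺-isStrictTotalOrder = record
    { isStrictPartialOrder = record
      { isEquivalence = isEquivalence
      ; irrefl        = λ x≡y x≺y → ≺-irrefl (subst (_ ≺_) (sym x≡y) x≺y)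
      ; trans         = ≺-trans
      ; <-resp-≈      = subst (_ ≺_) , subst (_≺ _)
      }
    ; compare = ≺-compare
    }

  private module R = Rank ≺-isStrictTotalOrder

  -- Preserving and reflecting the order determines this permutation, so the counting behind it can
  -- be hidden.
  abstract
    sorting : Permutation′ n
    sorting = R.rankₚ

    sorting-mono : ∀ {x y} → x ≺ y → sorting ⟨$⟩ʳ x < sorting ⟨$⟩ʳ y
    sorting-mono = R.rank-mono

    sorting-reflects : ∀ {x y} → sorting ⟨$⟩ʳ x < sorting ⟨$⟩ʳ y → x ≺ y
    sorting-reflects = R.rank-reflects

-- Maps that respect labels and steps.

module _ {n} {c c′ : Fin n → ℕ} {π π′ : Fin n → Fin n} (h : Fin n → Fin n)
  (c′h≡c : ∀ x → c′ (h x) ≡ c x) (π′h≡hπ : ∀ x → π′ (h x) ≡ h (π x)) where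
  private
    module W = Words c π
    module W′ = Words c′ π′

  -- Such a map `h` leaves the word of each point unchanged. It is applied to the identity, for two
  -- functions that agree pointwise, and to the sorting permutation.
  map-⊏ : ∀ {x y} → x W.⊏ y → h x W′.⊏ h y
  map-⊏ {x} {y} (W.here x<y) = W′.here (subst₂ ℕ._<_ (sym (c′h≡c x)) (sym (c′h≡c y)) x<y)
  map-⊏ {x} {y} (W.there x≡y x⊏y) = W′.there (trans (c′h≡c x) (trans x≡y (sym (c′h≡c y))))
    (subst₂ W′._⊏_ (sym (π′h≡hπ x)) (sym (π′h≡hπ y)) (map-⊏ x⊏y))

  iterate-map : ∀ x k → iterate π′ (h x) k ≡ h (iterate π x k)
  iterate-map x zero    = refl
  iterate-map x (suc k) = trans (cong (λ z → iterate π′ z k) (π′h≡hπ x)) (iterate-map (π x) k)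

  map-≋ : ∀ {x y} → x W.≋ y → h x W′.≋ h y
  map-≋ {x} {y} x≋y k = trans (word x) (trans (x≋y k) (sym (word y)))
    where
    word : ∀ z → c′ (iterate π′ (h z) k) ≡ c (iterate π z k)
    word z = trans (cong c′ (iterate-map z k)) (c′h≡c (iterate π z k))

-- Conjugation by the sorting permutation.

reorder : ∀ {n} → (Fin n → ℕ) → Permutation′ n → Permutation′ n
reorder c π = conjugate (Words.sorting c (π ⟨$⟩ʳ_)) π

cycleStructure-reorder : ∀ {n} (c : Fin n → ℕ) π → cycleStructure (reorder c π) ≡ cycleStructure π
cycleStructure-reorder c π = cycleStructure-conjugate (Words.sorting c (π ⟨$⟩ʳ_)) π

-- Pointwise equal functions are not interchangeable by substitution. Their word orders coincide,
-- however, and an order determines its sorting permutation.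
reorder-cong : ∀ {n} (c : Fin n → ℕ) {π σ} → π ≈ σ → reorder c π ≈ reorder c σ
reorder-cong c {π} {σ} π≈σ x = begin
  rπ ⟨$⟩ʳ (π ⟨$⟩ʳ (rπ ⟨$⟩ˡ x))   ≡⟨ rπ≈rσ _ ⟩
  rσ ⟨$⟩ʳ (π ⟨$⟩ʳ (rπ ⟨$⟩ˡ x))   ≡⟨ cong (rσ ⟨$⟩ʳ_) (π≈σ _) ⟩
  rσ ⟨$⟩ʳ (σ ⟨$⟩ʳ (rπ ⟨$⟩ˡ x))   ≡⟨ cong (λ z → rσ ⟨$⟩ʳ (σ ⟨$⟩ʳ z)) rπ⁻¹x ⟩
  rσ ⟨$⟩ʳ (σ ⟨$⟩ʳ (rσ ⟨$⟩ˡ x))   ∎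
  where
  open ≡-Reasoning
  module Wπ = Words c (π ⟨$⟩ʳ_)
  module Wσ = Words c (σ ⟨$⟩ʳ_)
  rπ = Wπ.sorting
  rσ = Wσ.sorting

  ≺-cong : ∀ {x y} → x Wπ.≺ y → x Wσ.≺ y
  ≺-cong (inj₁ x⊏y)         = inj₁ (map-⊏ {c = c} {c′ = c} id (λ _ → refl) (sym ∘ π≈σ) x⊏y)
  ≺-cong (inj₂ (x≋y , x<y)) = inj₂ (map-≋ {c = c} {c′ = c} id (λ _ → refl) (sym ∘ π≈σ) x≋y , x<y)

  rπ≈rσ : rπ ≈ rσ
  rπ≈rσ = order-preserving-≈ rπ rσ (Wσ.sorting-mono ∘ ≺-cong ∘ Wπ.sorting-reflects)

  rπ⁻¹x : rπ ⟨$⟩ˡ x ≡ rσ ⟨$⟩ˡ x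
  rπ⁻¹x = permutation-injective rσ (trans (sym (rπ≈rσ _)) (trans (inverseʳ rπ) (sym (inverseʳ rσ))))

-- Monotonicity of the reordered permutation and recovery of the original.

module _ {n} {f g : Fin n → ℕ} (f-inc : Increasing f) (g-inc : Increasing g) (φ : FibreBijection f g)
  (π : Permutation′ n) (π-inc : IncreasingOnFibres f (π ⟨$⟩ʳ_)) where
  private
    c = g ∘ to φ
    -- The labels for the way back: a position on the `g` side carries the `f`-label of its partner.
    c⁻ = f ∘ from φ
    π′ = reorder c π
    module F = Words f (π ⟨$⟩ʳ_)
    module W = Words c (π ⟨$⟩ʳ_)
    module W′ = Words c⁻ (π′ ⟨$⟩ʳ_)
    open W using (_≺_; here; there; sorting-mono; sorting-reflects)
    r = W.sorting
    r′ = W′.sorting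

  -- Sorting by words sorts by first letters, so the labels `c` listed in sorted order form an
  -- increasing rearrangement of the increasing `g`, hence `g` itself.
  sorting-fibre : ∀ x → g (r ⟨$⟩ʳ x) ≡ c x
  sorting-fibre x = trans
    (sym (increasing-rearrangement c∘r⁻¹-inc g-inc (flip r ∘ₚ bijection φ) (λ _ → refl) (r ⟨$⟩ʳ x)))
    (cong c (inverseˡ r))
    where
    c∘r⁻¹-inc : Increasing (λ y → c (r ⟨$⟩ˡ y))
    c∘r⁻¹-inc {x} {y} x≤y = ℕ.≮⇒≥ λ cy<cx →
      ℕ.≤⇒≯ x≤y (subst₂ _<_ (inverseʳ r) (inverseʳ r) (sorting-mono (inj₁ (here cy<cx))))

  ≺-π : ∀ {x y} → x ≺ y → c x ≡ c y → (π ⟨$⟩ʳ x) ≺ (π ⟨$⟩ʳ y)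
  ≺-π (inj₁ (here  x<y))   x≡y = contradiction x≡y (ℕ.<⇒≢ x<y)
  ≺-π (inj₁ (there _ x⊏y)) x≡y = inj₁ x⊏y
  -- For equal words the tie-break must survive `π`: equal `c`-labels are equal `f`-labels, and `π`
  -- increases on the fibres of `f`.
  ≺-π (inj₂ (x≋y , x<y))   x≡y = inj₂ (x≋y ∘ suc , π-inc x<y (Equivalence.from (same-fibre φ _ _) x≡y))

  -- Pulled back along `r`, the fibres of `g` become those of `c`, where `≺-π` deletes the common
  -- first letter.
  reorder-increasing : IncreasingOnFibres g (π′ ⟨$⟩ʳ_)
  reorder-increasing {x} {y} x<y gx≡gy = sorting-mono (≺-π
    (sorting-reflects (subst₂ _<_ (sym (inverseʳ r)) (sym (inverseʳ r)) x<y))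
    (trans (sym (fibre x)) (trans gx≡gy (fibre y))))
    where
    fibre : ∀ y → g y ≡ c (r ⟨$⟩ˡ y)
    fibre y = trans (cong g (sym (inverseʳ r))) (sorting-fibre (r ⟨$⟩ˡ y))

  -- As `f` increases, a smaller point cannot have the larger first letter; if the first letters
  -- agree, `π` keeps the order of the two points and the argument repeats.
  <⇒¬⊏ : ∀ {x y} → x < y → ¬ (y F.⊏ x)
  <⇒¬⊏ x<y (F.here  fy<fx)     = ℕ.<⇒≱ fy<fx (f-inc (ℕ.<⇒≤ x<y))
  <⇒¬⊏ x<y (F.there fy≡fx y⊏x) = <⇒¬⊏ (π-inc x<y (sym fy≡fx)) y⊏x

  <-via-words : ∀ {x y} → x < y → x F.≺ y
  <-via-words {x} {y} x<y with F.compareWords x y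
  ... | inj₁ x⊏y        = inj₁ x⊏y
  ... | inj₂ (inj₁ x≋y) = inj₂ (x≋y , x<y)
  ... | inj₂ (inj₂ y⊏x) = contradiction y⊏x (<⇒¬⊏ x<y)

  -- `r ⟨$⟩ʳ x` and `to φ x` may differ but share a fibre of `g`, so their partners share a fibre of
  -- `f`.
  f-from-sorting : ∀ x → f (from φ (r ⟨$⟩ʳ x)) ≡ f x
  f-from-sorting x = Equivalence.from (same-fibre φ _ _)
    (trans (cong g (strictlyInverseˡ φ _)) (sorting-fibre x))

  sorting-<⇒≺ : ∀ {x y} → x < y → (r ⟨$⟩ʳ x) W′.≺ (r ⟨$⟩ʳ y)
  sorting-<⇒≺ x<y with <-via-words x<y
  ... | inj₁ x⊏y       = inj₁ (map-⊏ {c = f} {c′ = c⁻} (r ⟨$⟩ʳ_) f-from-sorting (conjugate-image r π) x⊏y)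
  -- A tie between `f`-words is a tie between `c`-words, so `r` keeps the order of `x` and `y`.
  ... | inj₂ (x≋y , _) = inj₂
    ( map-≋ {c = f} {c′ = c⁻} (r ⟨$⟩ʳ_) f-from-sorting (conjugate-image r π) x≋y
    , sorting-mono (inj₂ ((λ k → Equivalence.to (same-fibre φ _ _) (x≋y k)) , x<y))
    )

  -- The image of a point under `r` has the `f`-word of that point, and `f`-words with ties already
  -- follow the usual order. Sorting the images therefore puts every point back.
  sorting-inverse : r ∘ₚ r′ ≈ Perm.id
  sorting-inverse x = sym (order-preserving-≈ Perm.id (r ∘ₚ r′) (W′.sorting-mono ∘ sorting-<⇒≺) x)

  reorder-inverse : reorder c⁻ π′ ≈ π
  reorder-inverse x = begin
    r′ ⟨$⟩ʳ (π′ ⟨$⟩ʳ (r′ ⟨$⟩ˡ x))              ≡⟨ cong (λ z → r′ ⟨$⟩ʳ (π′ ⟨$⟩ʳ z)) r′⁻¹x ⟩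
    r′ ⟨$⟩ʳ (π′ ⟨$⟩ʳ (r ⟨$⟩ʳ x))               ≡⟨ cong (r′ ⟨$⟩ʳ_) (conjugate-image r π x) ⟩
    r′ ⟨$⟩ʳ (r ⟨$⟩ʳ (π ⟨$⟩ʳ x))                ≡⟨ sorting-inverse (π ⟨$⟩ʳ x) ⟩
    π ⟨$⟩ʳ x                                   ∎
    where
    open ≡-Reasoning
    r′⁻¹x : r′ ⟨$⟩ˡ x ≡ r ⟨$⟩ʳ x
    r′⁻¹x = permutation-injective r′ (trans (inverseʳ r′) (sym (sorting-inverse x)))

-- The bijection between the two sets of permutations.

proposition5p2 : (m : ℕ) (I J : Subset m) → associatedPartition I ≡ associatedPartition J →
    Σ[ f ∈ Bijection (DescentsWithin I) (DescentsWithin J) ]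
    ((π : Setoid.Carrier (DescentsWithin I)) → cycleStructure (proj₁ (Bijection.to f π)) ≡ cycleStructure (proj₁ π))
proposition5p2 m I J eq = Inverse⇒Bijection inverse , λ (π , _) → cycleStructure-reorder _ π
  where
  φ : FibreBijection (block I) (block J)
  φ = block-↭ I J (sortDescending-injective eq)

  φ⁻¹ : FibreBijection (block J) (block I)
  φ⁻¹ = FibreBijection-sym φ

  transport : ∀ {K L} → FibreBijection (block K) (block L) →
    Setoid.Carrier (DescentsWithin K) → Setoid.Carrier (DescentsWithin L)
  transport {K} {L} ψ (π , D⊆K) = reorder (block L ∘ to ψ) π ,
    increasing⇒D⊆ L (reorder (block L ∘ to ψ) π)
      (reorder-increasing (block-mono K) (block-mono L) ψ π (D⊆⇒increasing K π D⊆K))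

  round-trip : ∀ {K L} (ψ : FibreBijection (block K) (block L)) (p : Setoid.Carrier (DescentsWithin K)) →
    proj₁ (transport (FibreBijection-sym ψ) (transport ψ p)) ≈ proj₁ p
  round-trip {K} {L} ψ (π , D⊆K) =
    reorder-inverse (block-mono K) (block-mono L) ψ π (D⊆⇒increasing K π D⊆K)

  transport-cong : ∀ {K L} (ψ : FibreBijection (block K) (block L)) p q →
    proj₁ p ≈ proj₁ q → proj₁ (transport ψ p) ≈ proj₁ (transport ψ q)
  transport-cong {L = L} ψ (π , _) (σ , _) = reorder-cong (block L ∘ to ψ) {π} {σ}

  inverse : Inverse (DescentsWithin I) (DescentsWithin J)
  inverse = record
    { to        = transport φ
    ; from      = transport φ⁻¹
    ; to-cong   = λ {p} {q} → transport-cong φ p q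
    ; from-cong = λ {p} {q} → transport-cong φ⁻¹ p q
    -- `round-trip φ⁻¹` involves `φ` reversed twice, whose underlying map is again that of `φ`; the
    -- resulting permutation depends only on this map.
    ; inverse   = (λ {p} {q} q≈ x → trans (transport-cong φ q (transport φ⁻¹ p) q≈ x) (round-trip φ⁻¹ p x))
                , (λ {p} {q} q≈ x → trans (transport-cong φ⁻¹ q (transport φ p) q≈ x) (round-trip φ p x))
    }
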